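{- Let $\mathcal A$ be a category with finite coproducts having monomorphic injections, and let $H,V:\mathcal A\to\mathcal A$ be endofunctors such that $H$, $V$ and $H+V$ are iteratable. Let $(A,a,(\,\_\,)^*)$ be a complete Elgot algebra for $H$, and let $e:V\to T(H+V)$ be a guarded recursive program scheme. Then: (i) there exists an interpreted solution $e^\ddagger_A: VA\to A$ of $e$ in $A$; (ii) if $A$ is a completely iterative algebra for $H$, then $e^\ddagger_A$ is the unique interpreted solution of $e$ in $A$.
   Context: Coproduct injections are written $\mathrm{inl},\mathrm{inr}$; identity morphisms are denoted by the name of the object. An endofunctor $H$ is iteratable if for every object $X$ the functor $H(\,\_\,)+X$ has a final coalgebra $\alpha^H_X: T(H)X\to H\,T(H)X+X$. This is an isomorphism; write $[\tau^H_X,\eta^H_X]=(\alpha^H_X)^{ -1}$. $T(H)$ is a monad $(T(H),\eta^H,\mu^H)$: for $f:X\to Y$, $T(H)f$ is the unique morphism with $T(H)f\cdot\tau^H_X=\tau^H_Y\cdot H\,T(H)f$ and $T(H)f\cdot\eta^H_X=\eta^H_Y\cdot f$; $\mu^H_X$ is the unique morphism with $\mu^H_X\cdot\tau^H_{T(H)X}=\tau^H_X\cdot H\mu^H_X$ and $\mu^H_X\cdot\eta^H_{T(H)X}=\mathrm{id}$. Put $\kappa^H=\tau^H\cdot H\eta^H:H\to T(H)$. A recursive program scheme (RPS) is a natural transformation $e:V\to T(H+V)$; it is guarded if $e=\tau^{H+V}\cdot(\mathrm{inl}\,T(H+V))\cdot f$ for some natural transformation $f:V\to H\,T(H+V)$.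 For guarded $e$ there is a unique monad morphism $\widehat e:T(H+V)\to T(H+V)$ with $\widehat e\cdot\kappa^{H+V}=[\kappa^{H+V}\cdot\mathrm{inl},\,e]$ (a fact following from freeness of $T(H+V)$). Flat equation morphisms and Elgot algebras. For an endofunctor $H$, a flat equation morphism in $A$ is a morphism $e:X\to HX+A$. A solution of $e$ in an $H$-algebra $(A,a)$ is $s:X\to A$ with $s=[a,A]\cdot(Hs+A)\cdot e$. $(A,a)$ is a completely iterative algebra (cia) if every flat equation morphism in $A$ has a unique solution. For $h:A\to B$ put $h\bullet e=(HX+h)\cdot e$. For $e:X\to HX+Y$ and $f:Y\to HY+A$ put $f\,\square\, e=(\mathrm{can}+A)\cdot(HX+f)\cdot[e,\mathrm{inr}]:X+Y\to H(X+Y)+A$, with $\mathrm{can}=[H\mathrm{inl},H\mathrm{inr}]$. A complete Elgot algebra for $H$ is a triple $(A,a,(\,\_\,)^*)$ where $(A,a)$ is an $H$-algebra and $(\,\_\,)^*$ assigns to every flat equation morphism $e:X\to HX+A$ a solution $e^*:X\to A$ such that: (Functoriality) if $e:X\to HX+A$, $f:Y\to HY+A$, $h:X\to Y$ satisfy $f\cdot h=(Hh+A)\cdot e$, then $e^*=f^*\cdot h$; (Compositionality) for $e:X\to HX+Y$ and $f:Y\to HY+A$, $(f^*\bullet e)^*=(f\,\square\, e)^*\cdot\mathrm{inl}$. Every cia is a complete Elgot algebra via its unique solutions. The evaluation morphism of a complete Elgot algebra $(A,a,(\,\_\,)^*)$ for an iteratable $H$ is $\widetilde a=(\alpha^H_A)^*:T(H)A\to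 A$. Interpreted solutions. Let $e$ be a guarded RPS and $(A,a)$ an $H$-algebra. An interpreted solution of $e$ in $A$ is a morphism $e^\ddagger_A:VA\to A$ such that there is an operation $(\,\_\,)^+$ of taking solutions for which (1) $(A,[a,e^\ddagger_A],(\,\_\,)^+)$ is a complete Elgot algebra for $H+V$, and (2) the evaluation morphism $\beta=\widetilde{[a,e^\ddagger_A]}:T(H+V)A\to A$ of that Elgot algebra satisfies $\beta\cdot\widehat e_A=\beta$. -}

module Defs where

open import Level using (Level; _⊔_) renaming (suc to lsuc)
open import Data.Product using (Σ-syntax; ∃!; _×_; _,_; proj₁; proj₂)
open import Relation.Binary.Bundles using (Setoid)
open import Relation.Binary.Structures using (IsEquivalence)
import Relation.Binary.Reasoning.Setoid as SetoidReasoning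

-- Hom-sets are setoids: equality of parallel morphisms is _≈_, and every
-- "unique morphism" below is unique up to _≈_.
record Category (o ℓ e : Level) : Set (lsuc (o ⊔ ℓ ⊔ e)) where
  infix  4 _≈_ _⇒_
  infixr 9 _∘_
  field
    Obj      : Set o
    _⇒_      : Obj → Obj → Set ℓ
    _≈_      : ∀ {A B} → A ⇒ B → A ⇒ B → Set e
    id       : ∀ {A} → A ⇒ A
    _∘_      : ∀ {A B C} → B ⇒ C → A ⇒ B → A ⇒ C
    assoc    : ∀ {A B C D} {f : A ⇒ B} {g : B ⇒ C} {h : C ⇒ D} →
               (h ∘ g) ∘ f ≈ h ∘ (g ∘ f)
    idˡ      : ∀ {A B} {f : A ⇒ B} → id ∘ f ≈ f
    idʳ      : ∀ {A B} {f : A ⇒ B} → f ∘ id ≈ f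
    equiv    : ∀ {A B} → IsEquivalence (_≈_ {A} {B})
    ∘-resp-≈ : ∀ {A B C} {f f′ : B ⇒ C} {g g′ : A ⇒ B} →
               f ≈ f′ → g ≈ g′ → f ∘ g ≈ f′ ∘ g′

  private
    module Equiv {A B : Obj} = IsEquivalence (equiv {A} {B})
  open Equiv public using () renaming (refl to ≈-refl; sym to ≈-sym; trans to ≈-trans)

  hom-setoid : Obj → Obj → Setoid ℓ e
  hom-setoid A B = record { Carrier = A ⇒ B ; _≈_ = _≈_ ; isEquivalence = equiv }

  module HomReasoning {A B : Obj} = SetoidReasoning (hom-setoid A B)

  infixr 4 _⟩∘⟨_ refl⟩∘⟨_
  infixl 5 _⟩∘⟨refl

  _⟩∘⟨_ : ∀ {A B C} {f f′ : B ⇒ C} {g g′ : A ⇒ B} →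
          f ≈ f′ → g ≈ g′ → f ∘ g ≈ f′ ∘ g′
  _⟩∘⟨_ = ∘-resp-≈

  refl⟩∘⟨_ : ∀ {A B C} {f : B ⇒ C} {g g′ : A ⇒ B} → g ≈ g′ → f ∘ g ≈ f ∘ g′
  refl⟩∘⟨ p = ∘-resp-≈ ≈-refl p

  _⟩∘⟨refl : ∀ {A B C} {f f′ : B ⇒ C} {g : A ⇒ B} → f ≈ f′ → f ∘ g ≈ f′ ∘ g
  p ⟩∘⟨refl = ∘-resp-≈ p ≈-refl

  pullˡ : ∀ {A B C D} {f : C ⇒ D} {g : B ⇒ C} {h : B ⇒ D} {k : A ⇒ B} →
          f ∘ g ≈ h → f ∘ (g ∘ k) ≈ h ∘ k
  pullˡ p = ≈-trans (≈-sym assoc) (p ⟩∘⟨refl)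

  pullʳ : ∀ {A B C D} {f : C ⇒ D} {g : B ⇒ C} {h : A ⇒ B} {k : A ⇒ C} →
          g ∘ h ≈ k → (f ∘ g) ∘ h ≈ f ∘ k
  pullʳ p = ≈-trans assoc (refl⟩∘⟨ p)

  cancelˡ : ∀ {A B C} {f : B ⇒ C} {g : C ⇒ B} {k : A ⇒ C} →
            f ∘ g ≈ id → f ∘ (g ∘ k) ≈ k
  cancelˡ p = ≈-trans (pullˡ p) idˡ

  Mono : ∀ {A B} → A ⇒ B → Set (o ⊔ ℓ ⊔ e)
  Mono {A} m = ∀ {X} (g h : X ⇒ A) → m ∘ g ≈ m ∘ h → g ≈ h

module _ {o ℓ e} (𝒜 : Category o ℓ e) where
  open Category 𝒜

  record Endofunctor : Set (o ⊔ ℓ ⊔ e) where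
    field
      F₀           : Obj → Obj
      F₁           : ∀ {A B} → A ⇒ B → F₀ A ⇒ F₀ B
      identity     : ∀ {A} → F₁ (id {A}) ≈ id
      homomorphism : ∀ {A B C} {f : A ⇒ B} {g : B ⇒ C} → F₁ (g ∘ f) ≈ F₁ g ∘ F₁ f
      F-resp-≈     : ∀ {A B} {f g : A ⇒ B} → f ≈ g → F₁ f ≈ F₁ g

  record FiniteCoproducts : Set (o ⊔ ℓ ⊔ e) where
    infixr 6 _+_
    field
      ⊥        : Obj
      ¡        : ∀ {A} → ⊥ ⇒ A
      ¡-unique : ∀ {A} (f : ⊥ ⇒ A) → ¡ ≈ f
      _+_      : Obj → Obj → Obj
      inl      : ∀ {A B} → A ⇒ A + B
      inr      : ∀ {A B} → B ⇒ A + B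
      [_,_]    : ∀ {A B C} → A ⇒ C → B ⇒ C → A + B ⇒ C
      []∘inl   : ∀ {A B C} {f : A ⇒ C} {g : B ⇒ C} → [ f , g ] ∘ inl ≈ f
      []∘inr   : ∀ {A B C} {f : A ⇒ C} {g : B ⇒ C} → [ f , g ] ∘ inr ≈ g
      []-unique : ∀ {A B C} {f : A ⇒ C} {g : B ⇒ C} {h : A + B ⇒ C} →
                  h ∘ inl ≈ f → h ∘ inr ≈ g → [ f , g ] ≈ h

    infixr 7 _+₁_
    _+₁_ : ∀ {A B C D} → A ⇒ C → B ⇒ D → A + B ⇒ C + D
    f +₁ g = [ inl ∘ f , inr ∘ g ]

    MonomorphicInjections : Set (o ⊔ ℓ ⊔ e)
    MonomorphicInjections = ∀ {A B} → Mono (inl {A} {B}) × Mono (inr {A} {B})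

    []-cong : ∀ {A B C} {f f′ : A ⇒ C} {g g′ : B ⇒ C} →
              f ≈ f′ → g ≈ g′ → [ f , g ] ≈ [ f′ , g′ ]
    []-cong p q = []-unique (≈-trans []∘inl (≈-sym p)) (≈-trans []∘inr (≈-sym q))

    ∘[] : ∀ {A B C D} {f : A ⇒ C} {g : B ⇒ C} {h : C ⇒ D} →
          h ∘ [ f , g ] ≈ [ h ∘ f , h ∘ g ]
    ∘[] = ≈-sym ([]-unique (pullʳ []∘inl) (pullʳ []∘inr))

    +-η : ∀ {A B C} {h : A + B ⇒ C} → [ h ∘ inl , h ∘ inr ] ≈ h
    +-η = []-unique ≈-refl ≈-refl

    +-ext : ∀ {A B C} {h k : A + B ⇒ C} → h ∘ inl ≈ k ∘ inl → h ∘ inr ≈ k ∘ inr → h ≈ k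
    +-ext p q = ≈-trans (≈-sym ([]-unique p q)) +-η

    []∘+₁ : ∀ {A B C D E} {f : C ⇒ E} {g : D ⇒ E} {h : A ⇒ C} {k : B ⇒ D} →
            [ f , g ] ∘ (h +₁ k) ≈ [ f ∘ h , g ∘ k ]
    []∘+₁ = ≈-trans ∘[] ([]-cong (pullˡ []∘inl) (pullˡ []∘inr))

    +₁-cong : ∀ {A B C D} {f f′ : A ⇒ C} {g g′ : B ⇒ D} →
              f ≈ f′ → g ≈ g′ → f +₁ g ≈ f′ +₁ g′
    +₁-cong p q = []-cong (refl⟩∘⟨ p) (refl⟩∘⟨ q)

    +₁-∘ : ∀ {A B C A′ B′ C′} {f : A ⇒ B} {g : B ⇒ C} {f′ : A′ ⇒ B′} {g′ : B′ ⇒ C′} →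
           (g ∘ f) +₁ (g′ ∘ f′) ≈ (g +₁ g′) ∘ (f +₁ f′)
    +₁-∘ = ≈-sym (≈-trans []∘+₁ ([]-cong assoc assoc))

    +₁-id : ∀ {A B} → id {A} +₁ id {B} ≈ id
    +₁-id = []-unique (≈-trans idˡ (≈-sym idʳ)) (≈-trans idˡ (≈-sym idʳ))

module _ {o ℓ e} {𝒜 : Category o ℓ e} where
  open Category 𝒜
  open Endofunctor

  Id : Endofunctor 𝒜
  Id = record
    { F₀ = λ X → X ; F₁ = λ f → f
    ; identity = ≈-refl ; homomorphism = ≈-refl ; F-resp-≈ = λ p → p }

  infixr 9 _∘F_
  _∘F_ : Endofunctor 𝒜 → Endofunctor 𝒜 → Endofunctor 𝒜
  G ∘F F = record
    { F₀ = λ X → F₀ G (F₀ F X)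
    ; F₁ = λ f → F₁ G (F₁ F f)
    ; identity = ≈-trans (F-resp-≈ G (identity F)) (identity G)
    ; homomorphism = ≈-trans (F-resp-≈ G (homomorphism F)) (homomorphism G)
    ; F-resp-≈ = λ p → F-resp-≈ G (F-resp-≈ F p) }

  record NaturalTransformation (F G : Endofunctor 𝒜) : Set (o ⊔ ℓ ⊔ e) where
    field
      component : ∀ X → F₀ F X ⇒ F₀ G X
      natural   : ∀ {X Y} (f : X ⇒ Y) → component Y ∘ F₁ F f ≈ F₁ G f ∘ component X
  open NaturalTransformation

  record Monad : Set (o ⊔ ℓ ⊔ e) where
    field
      functor : Endofunctor 𝒜
      unit    : NaturalTransformation Id functor
      mult    : NaturalTransformation (functor ∘F functor) functor
    private
      M₀ = F₀ functor
      η  = component unit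
      μ  = component mult
    field
      identityˡ : ∀ {X} → μ X ∘ F₁ functor (η X) ≈ id
      identityʳ : ∀ {X} → μ X ∘ η (M₀ X) ≈ id
      mult-assoc : ∀ {X} → μ X ∘ F₁ functor (μ X) ≈ μ X ∘ μ (M₀ X)

  record MonadMorphism (M N : Monad) : Set (o ⊔ ℓ ⊔ e) where
    private
      module M = Monad M
      module N = Monad N
    field
      transformation : NaturalTransformation M.functor N.functor
    private
      m = component transformation
    field
      preserves-unit : ∀ {X} → m X ∘ component M.unit X ≈ component N.unit X
      preserves-mult : ∀ {X} → m X ∘ component M.mult X
                     ≈ component N.mult X ∘ (F₁ N.functor (m X) ∘ m (F₀ M.functor X))

  infix 4 _≃_
  _≃_ : ∀ {M N} → MonadMorphism M N → MonadMorphism M N → Set (o ⊔ e)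
  m ≃ n = ∀ X → component (MonadMorphism.transformation m) X
              ≈ component (MonadMorphism.transformation n) X

  record FinalCoalgebra (F : Endofunctor 𝒜) : Set (o ⊔ ℓ ⊔ e) where
    field
      carrier       : Obj
      out           : carrier ⇒ F₀ F carrier
      unfold        : ∀ {Y} → Y ⇒ F₀ F Y → Y ⇒ carrier
      unfold-comm   : ∀ {Y} {c : Y ⇒ F₀ F Y} → out ∘ unfold c ≈ F₁ F (unfold c) ∘ c
      unfold-unique : ∀ {Y} {c : Y ⇒ F₀ F Y} {h : Y ⇒ carrier} →
                      out ∘ h ≈ F₁ F h ∘ c → unfold c ≈ h

    unfold-unique₂ : ∀ {Y} (c : Y ⇒ F₀ F Y) {h k : Y ⇒ carrier} →
                     out ∘ h ≈ F₁ F h ∘ c → out ∘ k ≈ F₁ F k ∘ c → h ≈ k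
    unfold-unique₂ c p q = ≈-trans (≈-sym (unfold-unique p)) (unfold-unique q)

    out⁻¹ : F₀ F carrier ⇒ carrier
    out⁻¹ = unfold (F₁ F out)

    out⁻¹∘out : out⁻¹ ∘ out ≈ id
    out⁻¹∘out = unfold-unique₂ out
      (≈-trans (pullˡ unfold-comm) (≈-sym (homomorphism F) ⟩∘⟨refl))
      (≈-trans idʳ (≈-sym (≈-trans (identity F ⟩∘⟨refl) idˡ)))

    out∘out⁻¹ : out ∘ out⁻¹ ≈ id
    out∘out⁻¹ = ≈-trans unfold-comm
      (≈-trans (≈-sym (homomorphism F)) (≈-trans (F-resp-≈ F out⁻¹∘out) (identity F)))

module Schemes {o ℓ e} {𝒜 : Category o ℓ e} (cop : FiniteCoproducts 𝒜) where
  open Category 𝒜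
  open FiniteCoproducts cop
  open Endofunctor
  open NaturalTransformation

  infixr 6 _⊕_
  _⊕_ : Endofunctor 𝒜 → Endofunctor 𝒜 → Endofunctor 𝒜
  H ⊕ V = record
    { F₀ = λ X → F₀ H X + F₀ V X
    ; F₁ = λ f → F₁ H f +₁ F₁ V f
    ; identity = ≈-trans (+₁-cong (identity H) (identity V)) +₁-id
    ; homomorphism = ≈-trans (+₁-cong (homomorphism H) (homomorphism V)) +₁-∘
    ; F-resp-≈ = λ p → +₁-cong (F-resp-≈ H p) (F-resp-≈ V p) }

  Const : Obj → Endofunctor 𝒜
  Const A = record
    { F₀ = λ _ → A ; F₁ = λ _ → id
    ; identity = ≈-refl ; homomorphism = ≈-sym idˡ ; F-resp-≈ = λ _ → ≈-refl }

  Iteratable : Endofunctor 𝒜 → Set (o ⊔ ℓ ⊔ e)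
  Iteratable H = ∀ X → FinalCoalgebra (H ⊕ Const X)

  record Algebra (H : Endofunctor 𝒜) : Set (o ⊔ ℓ) where
    constructor _,_
    field
      carrier   : Obj
      structure : F₀ H carrier ⇒ carrier

  FlatEquation : Endofunctor 𝒜 → Obj → Obj → Set ℓ
  FlatEquation H X A = X ⇒ F₀ H X + A

  IsSolution : ∀ {H X} (𝔸 : Algebra H) → FlatEquation H X (Algebra.carrier 𝔸) →
               X ⇒ Algebra.carrier 𝔸 → Set e
  IsSolution {H} (A , a) eq s = s ≈ [ a , id ] ∘ ((F₁ H s +₁ id) ∘ eq)

  IsCompletelyIterative : ∀ {H} → Algebra H → Set (o ⊔ ℓ ⊔ e)
  IsCompletelyIterative {H} 𝔸 =
    ∀ {X} (eq : FlatEquation H X (Algebra.carrier 𝔸)) → ∃! _≈_ (IsSolution 𝔸 eq)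

  module _ (H : Endofunctor 𝒜) where
    infixr 8 _•_ _□_

    _•_ : ∀ {X A B} → A ⇒ B → FlatEquation H X A → FlatEquation H X B
    h • eq = (id +₁ h) ∘ eq

    can : ∀ {X Y} → F₀ H X + F₀ H Y ⇒ F₀ H (X + Y)
    can = [ F₁ H inl , F₁ H inr ]

    assocˡ : ∀ {A B C} → A + (B + C) ⇒ (A + B) + C
    assocˡ = [ inl ∘ inl , [ inl ∘ inr , inr ] ]

    -- The associativity isomorphism, left implicit on paper, sits between the
    -- codomain HX + (HY + A) of id +₁ f and the domain (HX + HY) + A of can +₁ id.
    _□_ : ∀ {X Y A} → FlatEquation H Y A → FlatEquation H X Y → FlatEquation H (X + Y) A
    f □ eq = (can +₁ id) ∘ (assocˡ ∘ ((id +₁ f) ∘ [ eq , inr ]))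

  record ElgotStructure {H : Endofunctor 𝒜} (𝔸 : Algebra H) : Set (o ⊔ ℓ ⊔ e) where
    open Algebra 𝔸 renaming (carrier to A)
    infix 10 _*
    field
      _*               : ∀ {X} → FlatEquation H X A → X ⇒ A
      solution         : ∀ {X} (eq : FlatEquation H X A) → IsSolution 𝔸 eq (eq *)
      functoriality    : ∀ {X Y} (eq : FlatEquation H X A) (f : FlatEquation H Y A)
                         (h : X ⇒ Y) → f ∘ h ≈ (F₁ H h +₁ id) ∘ eq → eq * ≈ f * ∘ h
      compositionality : ∀ {X Y} (eq : FlatEquation H X Y) (f : FlatEquation H Y A) →
                         (_•_ H (f *) eq) * ≈ (_□_ H f eq) * ∘ inl

  record CompleteElgotAlgebra (H : Endofunctor 𝒜) : Set (o ⊔ ℓ ⊔ e) where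
    field
      algebra        : Algebra H
      elgotStructure : ElgotStructure algebra
    open Algebra algebra public
    open ElgotStructure elgotStructure public

  module T (H : Endofunctor 𝒜) (it : Iteratable H) where
    private module Fin X = FinalCoalgebra (it X)

    T₀ : Obj → Obj
    T₀ X = Fin.carrier X

    α : ∀ X → T₀ X ⇒ F₀ H (T₀ X) + X
    α X = Fin.out X

    α⁻¹ : ∀ X → F₀ H (T₀ X) + X ⇒ T₀ X
    α⁻¹ X = Fin.out⁻¹ X

    τ : ∀ X → F₀ H (T₀ X) ⇒ T₀ X
    τ X = α⁻¹ X ∘ inl

    η : ∀ X → X ⇒ T₀ X
    η X = α⁻¹ X ∘ inr

    [τ,η]≈α⁻¹ : ∀ {X} → [ τ X , η X ] ≈ α⁻¹ X
    [τ,η]≈α⁻¹ = +-η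

    evaluation : (𝔸 : CompleteElgotAlgebra H) →
                 T₀ (CompleteElgotAlgebra.carrier 𝔸) ⇒ CompleteElgotAlgebra.carrier 𝔸
    evaluation 𝔸 = α A *
      where open CompleteElgotAlgebra 𝔸 renaming (carrier to A)

    open HomReasoning

    α∘τ : ∀ {X} → α X ∘ τ X ≈ inl
    α∘τ {X} = cancelˡ (Fin.out∘out⁻¹ X)

    α∘η : ∀ {X} → α X ∘ η X ≈ inr
    α∘η {X} = cancelˡ (Fin.out∘out⁻¹ X)

    T-ext : ∀ {X Y} {h k : T₀ X ⇒ Y} → h ∘ τ X ≈ k ∘ τ X → h ∘ η X ≈ k ∘ η X → h ≈ k
    T-ext {X} {h = h} {k} p q = begin
      h                        ≈⟨ ≈-sym idʳ ⟩
      h ∘ id                   ≈⟨ refl⟩∘⟨ ≈-sym (Fin.out⁻¹∘out X) ⟩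
      h ∘ (α⁻¹ X ∘ α X)        ≈⟨ ≈-sym assoc ⟩
      (h ∘ α⁻¹ X) ∘ α X        ≈⟨ +-ext (≈-trans assoc (≈-trans p (≈-sym assoc)))
                                        (≈-trans assoc (≈-trans q (≈-sym assoc))) ⟩∘⟨refl ⟩
      (k ∘ α⁻¹ X) ∘ α X        ≈⟨ assoc ⟩
      k ∘ (α⁻¹ X ∘ α X)        ≈⟨ refl⟩∘⟨ Fin.out⁻¹∘out X ⟩
      k ∘ id                   ≈⟨ idʳ ⟩
      k                        ∎

    free : ∀ X → Algebra H
    free X = T₀ X , τ X

    module _ {Y Z : Obj} (c : FlatEquation H Y (T₀ Z)) where
      unravel : T₀ Z ⇒ F₀ H (Y + T₀ Z) + Z
      unravel = (F₁ H inr +₁ id) ∘ α Z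

      system : Y + T₀ Z ⇒ F₀ H (Y + T₀ Z) + Z
      system = [ [ inl ∘ F₁ H inl , unravel ] ∘ c , unravel ]

      step : ∀ {h : Y + T₀ Z ⇒ T₀ Z} → h ∘ inr ≈ id → (F₁ H h +₁ id) ∘ unravel ≈ α Z
      step {h} p = begin
        (F₁ H h +₁ id) ∘ ((F₁ H inr +₁ id) ∘ α Z)
          ≈⟨ pullˡ (≈-sym +₁-∘) ⟩
        ((F₁ H h ∘ F₁ H inr) +₁ (id ∘ id)) ∘ α Z
          ≈⟨ +₁-cong (≈-trans (≈-sym (homomorphism H)) (≈-trans (F-resp-≈ H p) (identity H))) idˡ
             ⟩∘⟨refl ⟩
        (id +₁ id) ∘ α Z
          ≈⟨ ≈-trans (+₁-id ⟩∘⟨refl) idˡ ⟩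
        α Z ∎

      step′ : ∀ {h : Y + T₀ Z ⇒ T₀ Z} → h ∘ inr ≈ id →
              (F₁ H h +₁ id) ∘ ([ inl ∘ F₁ H inl , unravel ] ∘ c)
              ≈ [ inl ∘ F₁ H (h ∘ inl) , α Z ] ∘ c
      step′ {h} p = pullˡ (≈-trans ∘[] ([]-cong
        (≈-trans (pullˡ []∘inl) (pullʳ (≈-sym (homomorphism H))))
        (step p)))

      flat : ∀ {s : Y ⇒ T₀ Z} →
             α Z ∘ ([ τ Z , id ] ∘ ((F₁ H s +₁ id) ∘ c)) ≈ [ inl ∘ F₁ H s , α Z ] ∘ c
      flat = ≈-trans (refl⟩∘⟨ pullˡ []∘+₁) (pullˡ (≈-trans ∘[] ([]-cong
        (pullˡ α∘τ) (≈-trans (refl⟩∘⟨ idˡ) idʳ))))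

      sol : Y + T₀ Z ⇒ T₀ Z
      sol = Fin.unfold Z system

      sol∘inr : sol ∘ inr ≈ id
      sol∘inr = Fin.unfold-unique₂ Z (α Z)
        (begin
          α Z ∘ (sol ∘ inr)                             ≈⟨ pullˡ (Fin.unfold-comm Z) ⟩
          ((F₁ H sol +₁ id) ∘ system) ∘ inr             ≈⟨ pullʳ []∘inr ⟩
          (F₁ H sol +₁ id) ∘ ((F₁ H inr +₁ id) ∘ α Z)   ≈⟨ pullˡ (≈-sym +₁-∘) ⟩
          ((F₁ H sol ∘ F₁ H inr) +₁ (id ∘ id)) ∘ α Z
            ≈⟨ +₁-cong (≈-sym (homomorphism H)) idˡ ⟩∘⟨refl ⟩
          (F₁ H (sol ∘ inr) +₁ id) ∘ α Z ∎)
        (≈-trans idʳ (≈-sym (≈-trans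
          (≈-trans (+₁-cong (identity H) ≈-refl) +₁-id ⟩∘⟨refl) idˡ)))

      α-inj : ∀ {W} {h k : W ⇒ T₀ Z} → α Z ∘ h ≈ α Z ∘ k → h ≈ k
      α-inj p = ≈-trans (≈-sym (cancelˡ (Fin.out⁻¹∘out Z)))
                  (≈-trans (refl⟩∘⟨ p) (cancelˡ (Fin.out⁻¹∘out Z)))

      exists : IsSolution (free Z) c (sol ∘ inl)
      exists = α-inj (begin
        α Z ∘ (sol ∘ inl)                                  ≈⟨ pullˡ (Fin.unfold-comm Z) ⟩
        ((F₁ H sol +₁ id) ∘ system) ∘ inl                  ≈⟨ pullʳ []∘inl ⟩
        (F₁ H sol +₁ id) ∘ ([ inl ∘ F₁ H inl , unravel ] ∘ c) ≈⟨ step′ sol∘inr ⟩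
        [ inl ∘ F₁ H (sol ∘ inl) , α Z ] ∘ c               ≈⟨ ≈-sym flat ⟩
        α Z ∘ ([ τ Z , id ] ∘ ((F₁ H (sol ∘ inl) +₁ id) ∘ c)) ∎)

      unique : ∀ {s} → IsSolution (free Z) c s → sol ∘ inl ≈ s
      unique {s} p = ≈-trans (Fin.unfold-unique Z hom ⟩∘⟨refl) []∘inl
        where
        hom : α Z ∘ [ s , id ] ≈ (F₁ H [ s , id ] +₁ id) ∘ system
        hom = begin
          α Z ∘ [ s , id ]               ≈⟨ ∘[] ⟩
          [ α Z ∘ s , α Z ∘ id ]         ≈⟨ []-cong
            (begin
              α Z ∘ s                                     ≈⟨ refl⟩∘⟨ p ⟩
              α Z ∘ ([ τ Z , id ] ∘ ((F₁ H s +₁ id) ∘ c)) ≈⟨ flat ⟩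
              [ inl ∘ F₁ H s , α Z ] ∘ c
                ≈⟨ []-cong (refl⟩∘⟨ F-resp-≈ H (≈-sym []∘inl)) ≈-refl ⟩∘⟨refl ⟩
              [ inl ∘ F₁ H ([ s , id ] ∘ inl) , α Z ] ∘ c ≈⟨ ≈-sym (step′ []∘inr) ⟩
              (F₁ H [ s , id ] +₁ id) ∘ ([ inl ∘ F₁ H inl , unravel ] ∘ c) ∎)
            (≈-trans idʳ (≈-sym (step []∘inr))) ⟩
          [ (F₁ H [ s , id ] +₁ id) ∘ ([ inl ∘ F₁ H inl , unravel ] ∘ c)
          , (F₁ H [ s , id ] +₁ id) ∘ unravel ] ≈⟨ ≈-sym ∘[] ⟩
          (F₁ H [ s , id ] +₁ id) ∘ system ∎

      free-solve : ∃! _≈_ (IsSolution (free Z) c)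
      free-solve = sol ∘ inl , exists , unique

    free-isCompletelyIterative : ∀ Z → IsCompletelyIterative (free Z)
    free-isCompletelyIterative Z c = free-solve c

    solve : ∀ {Y Z} → FlatEquation H Y (T₀ Z) → Y ⇒ T₀ Z
    solve c = proj₁ (free-solve c)

    solve-unique₂ : ∀ {Y Z} (c : FlatEquation H Y (T₀ Z)) {s t : Y ⇒ T₀ Z} →
                    IsSolution (free Z) c s → IsSolution (free Z) c t → s ≈ t
    solve-unique₂ c p q = ≈-trans (≈-sym (proj₂ (proj₂ (free-solve c)) p)) (proj₂ (proj₂ (free-solve c)) q)

    lift-eq : ∀ {X Z} → X ⇒ T₀ Z → FlatEquation H (T₀ X) (T₀ Z)
    lift-eq {X} f = [ inl , inr ∘ f ] ∘ α X

    split : ∀ {X Y Z} {h : T₀ X ⇒ Z} {p : F₀ H (T₀ X) ⇒ Y} {q : X ⇒ Y} {k : Y ⇒ Z} →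
            h ∘ τ X ≈ k ∘ p → h ∘ η X ≈ k ∘ q → h ≈ k ∘ ([ p , q ] ∘ α X)
    split P Q = T-ext
      (≈-trans P (≈-sym (pullʳ (≈-trans (pullʳ α∘τ) []∘inl))))
      (≈-trans Q (≈-sym (pullʳ (≈-trans (pullʳ α∘η) []∘inr))))

    solves-inl : ∀ {Y Z} {s : Y ⇒ T₀ Z} →
                 ([ τ Z , id ] ∘ (F₁ H s +₁ id)) ∘ inl ≈ τ Z ∘ F₁ H s
    solves-inl = ≈-trans ([]∘+₁ ⟩∘⟨refl) []∘inl

    solves-inr : ∀ {W Y Z} {s : Y ⇒ T₀ Z} {g : W ⇒ T₀ Z} →
                 ([ τ Z , id ] ∘ (F₁ H s +₁ id)) ∘ (inr ∘ g) ≈ g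
    solves-inr = ≈-trans ([]∘+₁ ⟩∘⟨refl) (≈-trans (pullˡ []∘inr) (≈-trans (idˡ ⟩∘⟨refl) idˡ))

    lift-solves : ∀ {X Z} {f : X ⇒ T₀ Z} {h : T₀ X ⇒ T₀ Z} →
                  h ∘ τ X ≈ τ Z ∘ F₁ H h → h ∘ η X ≈ f → IsSolution (free Z) (lift-eq f) h
    lift-solves p q = ≈-trans
      (split (≈-trans p (≈-sym solves-inl)) (≈-trans q (≈-sym solves-inr))) assoc

    -- f ♯ is the unique homomorphism of H-algebras extending f along η
    infix 10 _♯
    _♯ : ∀ {X Z} → X ⇒ T₀ Z → T₀ X ⇒ T₀ Z
    f ♯ = solve (lift-eq f)

    ♯-solution : ∀ {X Z} (f : X ⇒ T₀ Z) → IsSolution (free Z) (lift-eq f) (f ♯)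
    ♯-solution f = proj₁ (proj₂ (free-solve (lift-eq f)))

    at : ∀ {X Y Z W} {s : Y ⇒ T₀ Z} {h : T₀ X ⇒ T₀ Z} {p : F₀ H (T₀ X) ⇒ F₀ H Y + T₀ Z}
         {q : X ⇒ F₀ H Y + T₀ Z} {g : W ⇒ T₀ X} {r : W ⇒ F₀ H Y + T₀ Z} →
         h ≈ [ τ Z , id ] ∘ ((F₁ H s +₁ id) ∘ ([ p , q ] ∘ α X)) →
         ([ p , q ] ∘ α X) ∘ g ≈ r →
         h ∘ g ≈ ([ τ Z , id ] ∘ (F₁ H s +₁ id)) ∘ r
    at P Q = ≈-trans (P ⟩∘⟨refl) (≈-trans (≈-sym assoc ⟩∘⟨refl) (pullʳ Q))

    ♯-τ : ∀ {X Z} {f : X ⇒ T₀ Z} → f ♯ ∘ τ X ≈ τ Z ∘ F₁ H (f ♯)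
    ♯-τ {f = f} = ≈-trans (at (♯-solution f) (≈-trans (pullʳ α∘τ) []∘inl)) solves-inl

    ♯-η : ∀ {X Z} {f : X ⇒ T₀ Z} → f ♯ ∘ η X ≈ f
    ♯-η {f = f} = ≈-trans (at (♯-solution f) (≈-trans (pullʳ α∘η) []∘inr)) solves-inr

    ♯-unique : ∀ {X Z} {f : X ⇒ T₀ Z} {h : T₀ X ⇒ T₀ Z} →
               h ∘ τ X ≈ τ Z ∘ F₁ H h → h ∘ η X ≈ f → f ♯ ≈ h
    ♯-unique {f = f} p q = solve-unique₂ (lift-eq f) (♯-solution f) (lift-solves p q)

    ♯-cong : ∀ {X Z} {f g : X ⇒ T₀ Z} → f ≈ g → f ♯ ≈ g ♯
    ♯-cong p = ♯-unique ♯-τ (≈-trans ♯-η (≈-sym p))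

    hom-∘ : ∀ {X Y Z} {h : T₀ Y ⇒ T₀ Z} {k : T₀ X ⇒ T₀ Y} →
            h ∘ τ Y ≈ τ Z ∘ F₁ H h → k ∘ τ X ≈ τ Y ∘ F₁ H k →
            (h ∘ k) ∘ τ X ≈ τ Z ∘ F₁ H (h ∘ k)
    hom-∘ p q = ≈-trans (pullʳ q) (≈-trans (pullˡ p) (pullʳ (≈-sym (homomorphism H))))

    ♯-∘ : ∀ {X Y Z} {g : Y ⇒ T₀ Z} {f : X ⇒ T₀ Y} → (g ♯ ∘ f) ♯ ≈ g ♯ ∘ f ♯
    ♯-∘ = ♯-unique (hom-∘ ♯-τ ♯-τ) (pullʳ ♯-η)

    η-♯ : ∀ {X} → η X ♯ ≈ id
    η-♯ = ♯-unique (≈-trans idˡ (≈-sym (≈-trans (refl⟩∘⟨ identity H) idʳ))) idˡ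

    T₁ : ∀ {X Y} → X ⇒ Y → T₀ X ⇒ T₀ Y
    T₁ {X} {Y} f = (η Y ∘ f) ♯

    T₁-characterized : ∀ {X Y} (f : X ⇒ Y) →
      (T₁ f ∘ τ X ≈ τ Y ∘ F₁ H (T₁ f)) × (T₁ f ∘ η X ≈ η Y ∘ f) ×
      (∀ {h} → h ∘ τ X ≈ τ Y ∘ F₁ H h → h ∘ η X ≈ η Y ∘ f → T₁ f ≈ h)
    T₁-characterized f = ♯-τ , ♯-η , ♯-unique

    μ : ∀ X → T₀ (T₀ X) ⇒ T₀ X
    μ X = id ♯

    μ-characterized : ∀ X →
      (μ X ∘ τ (T₀ X) ≈ τ X ∘ F₁ H (μ X)) × (μ X ∘ η (T₀ X) ≈ id) ×
      (∀ {h} → h ∘ τ (T₀ X) ≈ τ X ∘ F₁ H h → h ∘ η (T₀ X) ≈ id → μ X ≈ h)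
    μ-characterized X = ♯-τ , ♯-η , ♯-unique

    ♯-T₁ : ∀ {X Y Z} {g : Y ⇒ T₀ Z} {f : X ⇒ Y} → g ♯ ∘ T₁ f ≈ (g ∘ f) ♯
    ♯-T₁ = ≈-trans (≈-sym ♯-∘) (♯-cong (pullˡ ♯-η))

    μ-T₁ : ∀ {X Y} {f : X ⇒ T₀ Y} → μ Y ∘ T₁ f ≈ f ♯
    μ-T₁ = ≈-trans ♯-T₁ (♯-cong idˡ)

    functor : Endofunctor 𝒜
    functor = record
      { F₀ = T₀ ; F₁ = T₁
      ; identity = ≈-trans (♯-cong idʳ) η-♯
      ; homomorphism = ≈-trans (♯-cong (≈-sym assoc)) (≈-sym ♯-T₁)
      ; F-resp-≈ = λ p → ♯-cong (refl⟩∘⟨ p) }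

    monad : Monad {𝒜 = 𝒜}
    monad = record
      { functor = functor
      ; unit = record { component = η ; natural = λ _ → ≈-sym ♯-η }
      ; mult = record
          { component = μ
          ; natural = λ f → ≈-trans μ-T₁ (≈-sym (≈-trans (≈-sym ♯-∘) (♯-cong idʳ))) }
      ; identityˡ = ≈-trans μ-T₁ η-♯
      ; identityʳ = ♯-η
      ; mult-assoc = ≈-trans μ-T₁ (≈-sym (≈-trans (≈-sym ♯-∘) (♯-cong idʳ))) }

    τ-natural : NaturalTransformation (H ∘F functor) functor
    τ-natural = record { component = τ ; natural = λ _ → ≈-sym ♯-τ }

    κ : ∀ X → F₀ H X ⇒ T₀ X
    κ X = τ X ∘ F₁ H (η X)

    -- Every transformation τ ∘ ρ : H → T with ρ : H → H T extends uniquely to a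
    -- monad morphism T → T.
    module _ (ρ : NaturalTransformation H (H ∘F functor)) where
      r = component ρ

      GuardedHom : ∀ {X Z} → T₀ X ⇒ T₀ Z → Set e
      GuardedHom {X} {Z} p = p ∘ τ X ≈ τ Z ∘ (F₁ H (p ♯) ∘ r (T₀ X))

      guarded-eq : ∀ {X Z} → X ⇒ T₀ Z → FlatEquation H (T₀ (T₀ X)) (T₀ Z)
      guarded-eq {X} g = [ inl , [ inl ∘ r (T₀ X) , inr ∘ g ] ∘ α X ] ∘ α (T₀ X)

      guarded-solves : ∀ {X Z} {g : X ⇒ T₀ Z} {p : T₀ X ⇒ T₀ Z} →
                       GuardedHom p → p ∘ η X ≈ g →
                       IsSolution (free Z) (guarded-eq g) (p ♯)
      guarded-solves P Q = ≈-trans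
        (split (≈-trans ♯-τ (≈-sym solves-inl))
               (≈-trans ♯-η (split
                 (≈-trans P (≈-trans (≈-sym assoc) (≈-sym (pullˡ solves-inl))))
                 (≈-trans Q (≈-sym solves-inr)))))
        assoc

      guarded-unique : ∀ {X Z} {p q : T₀ X ⇒ T₀ Z} →
                       GuardedHom p → GuardedHom q → p ∘ η X ≈ q ∘ η X → p ≈ q
      guarded-unique {q = q} P Q E =
        ≈-trans (≈-sym ♯-η) (≈-trans
          (solve-unique₂ (guarded-eq (q ∘ η _)) (guarded-solves P E) (guarded-solves Q ≈-refl)
            ⟩∘⟨refl)
          ♯-η)

      u : ∀ X → T₀ (T₀ X) ⇒ T₀ X
      u X = solve (guarded-eq (η X))

      u-solution : ∀ X → IsSolution (free X) (guarded-eq (η X)) (u X)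
      u-solution X = proj₁ (proj₂ (free-solve (guarded-eq (η X))))

      t : ∀ X → T₀ X ⇒ T₀ X
      t X = u X ∘ η (T₀ X)

      u-τ : ∀ {X} → u X ∘ τ (T₀ X) ≈ τ X ∘ F₁ H (u X)
      u-τ {X} = ≈-trans (at (u-solution X) (≈-trans (pullʳ α∘τ) []∘inl)) solves-inl

      t♯ : ∀ {X} → t X ♯ ≈ u X
      t♯ = ♯-unique u-τ ≈-refl

      t-body : ∀ {X} → t X ≈ ([ τ X , id ] ∘ (F₁ H (u X) +₁ id))
                               ∘ ([ inl ∘ r (T₀ X) , inr ∘ η X ] ∘ α X)
      t-body {X} = at (u-solution X) (≈-trans (pullʳ α∘η) []∘inr)

      t-η : ∀ {X} → t X ∘ η X ≈ η X
      t-η = ≈-trans (t-body ⟩∘⟨refl)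
        (≈-trans (pullʳ (≈-trans (pullʳ α∘η) []∘inr)) solves-inr)

      t-guarded : ∀ {X} → GuardedHom (t X)
      t-guarded = ≈-trans (t-body ⟩∘⟨refl)
        (≈-trans (pullʳ (≈-trans (pullʳ α∘τ) []∘inl))
          (≈-trans (pullˡ solves-inl) (≈-trans assoc
            (refl⟩∘⟨ (F-resp-≈ H (≈-sym t♯) ⟩∘⟨refl)))))

      ∘-homˡ : ∀ {X Y Z} {h : Y ⇒ T₀ Z} {p : T₀ X ⇒ T₀ Y} →
               GuardedHom p → GuardedHom (h ♯ ∘ p)
      ∘-homˡ P = ≈-trans (pullʳ P) (≈-trans (pullˡ ♯-τ) (≈-trans assoc
        (refl⟩∘⟨ pullˡ (≈-trans (≈-sym (homomorphism H)) (F-resp-≈ H (≈-sym ♯-∘))))))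

      ∘-homʳ : ∀ {X Y Z} {p : T₀ Y ⇒ T₀ Z} {h : X ⇒ T₀ Y} →
               GuardedHom p → GuardedHom (p ∘ h ♯)
      ∘-homʳ P = ≈-trans (pullʳ ♯-τ) (≈-trans (pullˡ P) (≈-trans assoc
        (refl⟩∘⟨ ≈-trans (pullʳ (natural ρ _)) (pullˡ (≈-trans (≈-sym (homomorphism H))
          (F-resp-≈ H ♯-T₁))))))

      t-natural : ∀ {X Y} (f : X ⇒ Y) → t Y ∘ T₁ f ≈ T₁ f ∘ t X
      t-natural f = guarded-unique (∘-homʳ t-guarded) (∘-homˡ t-guarded)
        (≈-trans (≈-trans (pullʳ ♯-η) (pullˡ t-η))
                 (≈-sym (≈-trans (pullʳ t-η) ♯-η)))

      t-mult : ∀ {X} → t X ∘ μ X ≈ μ X ∘ (T₁ (t X) ∘ t (T₀ X))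
      t-mult {X} = ≈-trans
        (guarded-unique (∘-homʳ t-guarded) (∘-homˡ t-guarded)
          (≈-trans (≈-trans (pullʳ ♯-η) idʳ) (≈-sym (≈-trans (pullʳ t-η) ♯-η))))
        (≈-sym (pullˡ μ-T₁))

      t-κ : ∀ {X} → t X ∘ κ X ≈ τ X ∘ r X
      t-κ {X} = begin
        t X ∘ (τ X ∘ F₁ H (η X))                              ≈⟨ pullˡ t-guarded ⟩
        (τ X ∘ (F₁ H (t X ♯) ∘ r (T₀ X))) ∘ F₁ H (η X)        ≈⟨ assoc ⟩
        τ X ∘ ((F₁ H (t X ♯) ∘ r (T₀ X)) ∘ F₁ H (η X))        ≈⟨ refl⟩∘⟨ pullʳ (natural ρ (η X)) ⟩
        τ X ∘ (F₁ H (t X ♯) ∘ (F₁ H (T₁ (η X)) ∘ r X))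
          ≈⟨ refl⟩∘⟨ pullˡ (≈-trans (≈-sym (homomorphism H))
               (≈-trans (F-resp-≈ H (≈-trans ♯-T₁ (≈-trans (♯-cong t-η) η-♯))) (identity H))) ⟩
        τ X ∘ (id ∘ r X)                                      ≈⟨ refl⟩∘⟨ idˡ ⟩
        τ X ∘ r X                                             ∎

      extension : ∃! (_≃_ {M = monad} {N = monad}) λ m → ∀ X →
        component (MonadMorphism.transformation m) X ∘ κ X ≈ τ X ∘ r X
      extension =
        record { transformation = record { component = t ; natural = t-natural }
               ; preserves-unit = t-η
               ; preserves-mult = t-mult }
        , (λ X → t-κ)
        , λ {m} m-κ X → guarded-unique t-guarded (hom m m-κ)
            (≈-trans t-η (≈-sym (MonadMorphism.preserves-unit m)))
        where
        τ-as-μκ : ∀ {X} → τ X ≈ μ X ∘ κ (T₀ X)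
        τ-as-μκ = ≈-sym (≈-trans (pullˡ ♯-τ) (≈-trans assoc (≈-trans
          (refl⟩∘⟨ ≈-trans (≈-sym (homomorphism H)) (≈-trans (F-resp-≈ H ♯-η) (identity H)))
          idʳ)))

        hom : (m : MonadMorphism monad monad) →
              let m′ = component (MonadMorphism.transformation m) in
              (∀ X → m′ X ∘ κ X ≈ τ X ∘ r X) → ∀ {X} → GuardedHom (m′ X)
        hom m m-κ {X} = begin
          m′ X ∘ τ X                             ≈⟨ refl⟩∘⟨ τ-as-μκ ⟩
          m′ X ∘ (μ X ∘ κ (T₀ X))                ≈⟨ pullˡ (MonadMorphism.preserves-mult m) ⟩
          (μ X ∘ (T₁ (m′ X) ∘ m′ (T₀ X))) ∘ κ (T₀ X)
            ≈⟨ (pullˡ μ-T₁ ⟩∘⟨refl) ⟩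
          (m′ X ♯ ∘ m′ (T₀ X)) ∘ κ (T₀ X)        ≈⟨ pullʳ (m-κ (T₀ X)) ⟩
          m′ X ♯ ∘ (τ (T₀ X) ∘ r (T₀ X))         ≈⟨ pullˡ ♯-τ ⟩
          (τ X ∘ F₁ H (m′ X ♯)) ∘ r (T₀ X)       ≈⟨ assoc ⟩
          τ X ∘ (F₁ H (m′ X ♯) ∘ r (T₀ X))       ∎
          where m′ = component (MonadMorphism.transformation m)

  module _ (H V : Endofunctor 𝒜) (it : Iteratable (H ⊕ V)) where
    private module T⟨H+V⟩ = T (H ⊕ V) it
    open T⟨H+V⟩ using (T₀; τ; η; κ; monad; functor; evaluation)

    RecursiveProgramScheme : Set (o ⊔ ℓ ⊔ e)
    RecursiveProgramScheme = NaturalTransformation V functor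

    Guarded : RecursiveProgramScheme → Set (o ⊔ ℓ ⊔ e)
    Guarded rps = Σ[ f ∈ NaturalTransformation V (H ∘F functor) ]
      (∀ X → component rps X ≈ τ X ∘ (inl ∘ component f X))

    module _ (rps : RecursiveProgramScheme) (guarded : Guarded rps) where

      κ∘inl : ∀ X → κ X ∘ inl ≈ τ X ∘ (inl ∘ F₁ H (η X))
      κ∘inl X = pullʳ []∘inl

      ρ : NaturalTransformation (H ⊕ V) ((H ⊕ V) ∘F functor)
      ρ = record
        { component = λ X → [ inl ∘ F₁ H (η X) , inl ∘ component f X ]
        ; natural = λ h → ≈-trans []∘+₁ (≈-trans ([]-cong
            (≈-trans (pullʳ (≈-trans (≈-sym (homomorphism H)) (≈-trans
              (F-resp-≈ H (≈-sym T⟨H+V⟩.♯-η)) (homomorphism H))))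
              (≈-trans (≈-sym assoc) (≈-sym (pullˡ []∘inl))))
            (≈-trans (pullʳ (natural f h))
              (≈-trans (≈-sym assoc) (≈-sym (pullˡ []∘inl)))))
            (≈-sym ∘[])) }
        where f = proj₁ guarded

      [κ∘inl,e]≈τ∘ρ : ∀ X → [ κ X ∘ inl , component rps X ] ≈ τ X ∘ component ρ X
      [κ∘inl,e]≈τ∘ρ X = ≈-trans ([]-cong (κ∘inl X) (proj₂ guarded X)) (≈-sym ∘[])

      ê-exists : ∃! (_≃_ {M = monad} {N = monad}) λ m → ∀ X →
        component (MonadMorphism.transformation m) X ∘ κ X ≈ [ κ X ∘ inl , component rps X ]
      ê-exists = proj₁ ext
               , (λ X → ≈-trans (proj₁ (proj₂ ext) X) (≈-sym ([κ∘inl,e]≈τ∘ρ X)))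
               , (λ {m} p → proj₂ (proj₂ ext) {m} (λ X → ≈-trans (p X) ([κ∘inl,e]≈τ∘ρ X)))
        where ext = T⟨H+V⟩.extension ρ

      ê : MonadMorphism monad monad
      ê = proj₁ ê-exists

      ê-component : ∀ X → T₀ X ⇒ T₀ X
      ê-component = component (MonadMorphism.transformation ê)

      record IsInterpretedSolution (𝔸 : Algebra H)
        (s : F₀ V (Algebra.carrier 𝔸) ⇒ Algebra.carrier 𝔸) : Set (o ⊔ ℓ ⊔ e) where
        open Algebra 𝔸 renaming (carrier to A; structure to a)
        field
          elgotStructure : ElgotStructure {H ⊕ V} (A , [ a , s ])
        β : T₀ A ⇒ A
        β = evaluation (record { algebra = A , [ a , s ] ; elgotStructure = elgotStructure })
        field
          β∘ê : β ∘ ê-component A ≈ β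

{-# OPTIONS --safe #-}
module Submission where

open import Level using (_⊔_)
open import Data.Product using (Σ-syntax; _×_; _,_; proj₁; proj₂)
open import Defs

-- Write T for T(H+V) and μ for its multiplication.  Unfolding the head symbol of
-- a term once, by means of the guarded scheme f : V → H T, is a flat equation
-- morphism δ : T A → H T A + A for H alone; let β = δ*.  Compositionality
-- gives β · μ = β · T β, so β is an Eilenberg–Moore algebra for T, hence the
-- evaluation of a complete Elgot algebra for H + V with structure [ a , e‡ ],
-- where e‡ = a · H β · f.  Moreover β · ê = β, because μ and the homomorphic
-- extension of ê are morphisms into δ from one and the same coalgebra.
-- Conversely, the evaluation of any interpreted solution is an Eilenberg–Moore
-- algebra by the same compositionality argument, and it solves δ; in a cia it
-- therefore equals β.

module _ {o ℓ e} {𝒜 : Category o ℓ e} (cop : FiniteCoproducts 𝒜) where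
  open Category 𝒜
  open FiniteCoproducts cop
  open Endofunctor
  open NaturalTransformation
  open Schemes cop
  open HomReasoning

  -- Flat equation morphisms over an arbitrary endofunctor.

  module _ (G : Endofunctor 𝒜) where

    private
      G₁ : ∀ {X Y} → X ⇒ Y → F₀ G X ⇒ F₀ G Y
      G₁ = F₁ G

    F₁-square : ∀ {X Y Y′ Z} {f : X ⇒ Y} {g : Y ⇒ Z} {f′ : X ⇒ Y′} {g′ : Y′ ⇒ Z} →
                g ∘ f ≈ g′ ∘ f′ → G₁ g ∘ G₁ f ≈ G₁ g′ ∘ G₁ f′
    F₁-square p = ≈-trans (≈-sym (homomorphism G))
                    (≈-trans (F-resp-≈ G p) (homomorphism G))

    F₁-inverse : ∀ {X Y} {f : X ⇒ Y} {g : Y ⇒ X} → g ∘ f ≈ id → G₁ g ∘ G₁ f ≈ id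
    F₁-inverse p = ≈-trans (≈-sym (homomorphism G))
                     (≈-trans (F-resp-≈ G p) (identity G))

    F₁-can : ∀ {X Y Z} {h : X ⇒ Z} {k : Y ⇒ Z} →
             G₁ [ h , k ] ∘ can G ≈ [ G₁ h , G₁ k ]
    F₁-can = ≈-trans ∘[] ([]-cong
      (≈-trans (≈-sym (homomorphism G)) (F-resp-≈ G []∘inl))
      (≈-trans (≈-sym (homomorphism G)) (F-resp-≈ G []∘inr)))

    -- A coalgebra morphism out of `f □ eq` splits into a morphism `k` out of `f` and a map `h` that
    -- follows `eq` until a parameter in `Y` is met, where `k` takes over. Compositionality is
    -- applied and verified through such pairs.
    □-morphism : ∀ {X Y Z A} {eq : FlatEquation G X Y} {f : FlatEquation G Y A}
                 {g : FlatEquation G Z A} {h : X ⇒ Z} {k : Y ⇒ Z} →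
                 g ∘ h ≈ [ inl ∘ G₁ h , g ∘ k ] ∘ eq →
                 g ∘ k ≈ (G₁ k +₁ id) ∘ f →
                 g ∘ [ h , k ] ≈ (G₁ [ h , k ] +₁ id) ∘ _□_ G f eq
    □-morphism {eq = eq} {f} {g} {h} {k} p q = ≈-sym (begin
      (G₁ [ h , k ] +₁ id) ∘ ((can G +₁ id) ∘ (assocˡ G ∘ ((id +₁ f) ∘ [ eq , inr ])))
        ≈⟨ pullˡ (≈-trans (≈-sym +₁-∘) (+₁-cong F₁-can idˡ)) ⟩
      ([ G₁ h , G₁ k ] +₁ id) ∘ (assocˡ G ∘ ((id +₁ f) ∘ [ eq , inr ]))
        ≈⟨ pullˡ regroup ⟩
      [ inl ∘ G₁ h , G₁ k +₁ id ] ∘ ((id +₁ f) ∘ [ eq , inr ])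
        ≈⟨ pullˡ (≈-trans []∘+₁ ([]-cong idʳ (≈-sym q))) ⟩
      [ inl ∘ G₁ h , g ∘ k ] ∘ [ eq , inr ]
        ≈⟨ ≈-trans ∘[] ([]-cong (≈-sym p) []∘inr) ⟩
      [ g ∘ h , g ∘ k ]
        ≈⟨ ≈-sym ∘[] ⟩
      g ∘ [ h , k ] ∎)
      where
      regroup : ([ G₁ h , G₁ k ] +₁ id) ∘ assocˡ G ≈ [ inl ∘ G₁ h , G₁ k +₁ id ]
      regroup = ≈-trans ∘[] ([]-cong
        (≈-trans (pullˡ []∘inl) (pullʳ []∘inl))
        (≈-trans ∘[] ([]-cong (≈-trans (pullˡ []∘inl) (pullʳ []∘inr)) []∘inr)))

    module _ {A : Obj} {a : F₀ G A ⇒ A} {X : Obj} {eq : FlatEquation G X A} {s : X ⇒ A}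
             (sol : IsSolution {G} (A , a) eq s) where

      solution-inl : ∀ {W} {g : W ⇒ X} {p} → eq ∘ g ≈ inl ∘ p → s ∘ g ≈ a ∘ (G₁ s ∘ p)
      solution-inl {g = g} {p} q = begin
        s ∘ g                                        ≈⟨ sol ⟩∘⟨refl ⟩
        ([ a , id ] ∘ ((G₁ s +₁ id) ∘ eq)) ∘ g       ≈⟨ pullʳ (pullʳ q) ⟩
        [ a , id ] ∘ ((G₁ s +₁ id) ∘ (inl ∘ p))      ≈⟨ refl⟩∘⟨ pullˡ []∘inl ⟩
        [ a , id ] ∘ ((inl ∘ G₁ s) ∘ p)              ≈⟨ refl⟩∘⟨ assoc ⟩
        [ a , id ] ∘ (inl ∘ (G₁ s ∘ p))              ≈⟨ pullˡ []∘inl ⟩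
        a ∘ (G₁ s ∘ p)                               ∎

      solution-inr : ∀ {W} {g : W ⇒ X} {p} → eq ∘ g ≈ inr ∘ p → s ∘ g ≈ p
      solution-inr {g = g} {p} q = begin
        s ∘ g                                        ≈⟨ sol ⟩∘⟨refl ⟩
        ([ a , id ] ∘ ((G₁ s +₁ id) ∘ eq)) ∘ g       ≈⟨ pullʳ (pullʳ q) ⟩
        [ a , id ] ∘ ((G₁ s +₁ id) ∘ (inr ∘ p))
          ≈⟨ refl⟩∘⟨ pullˡ (≈-trans []∘inr idʳ) ⟩
        [ a , id ] ∘ (inr ∘ p)                       ≈⟨ cancelˡ []∘inr ⟩
        p                                            ∎

  -- Elgot algebras induce Eilenberg-Moore algebras.

  module _ (K : Endofunctor 𝒜) (it : Iteratable K) where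
    open T K it
    private module Fin X = FinalCoalgebra (it X)

    record IsEilenbergMoore {A : Obj} (β : T₀ A ⇒ A) : Set e where
      field
        unital         : β ∘ η A ≈ id
        multiplicative : β ∘ μ A ≈ β ∘ T₁ β

    -- Abstracts what the Eilenberg-Moore argument needs of a one-step unfolding of terms: variables
    -- are left alone, and unfolding commutes with substitution. `G` may differ from `K`, so that
    -- one argument covers both `α` and the unfolding of heads by a scheme.
    record Unfolding (G : Endofunctor 𝒜) : Set (o ⊔ ℓ ⊔ e) where
      field
        δ   : ∀ X → FlatEquation G (T₀ X) X
        δ-η : ∀ {X} → δ X ∘ η X ≈ inr
        δ-♯ : ∀ {X Z} {g : X ⇒ T₀ Z} →
              δ Z ∘ g ♯ ≈ [ inl ∘ F₁ G (g ♯) , δ Z ∘ g ] ∘ δ X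

      module _ {𝔸 : Algebra G} (E : ElgotStructure {G} 𝔸) where
        open Algebra 𝔸 renaming (carrier to A)
        open ElgotStructure E

        -- Compositionality equates two ways of solving nested terms. The inner layer solved first
        -- gives `β • δ`, which `T₁ β` maps into `δ A`; both layers solved jointly give `δ □ δ`,
        -- which `[ μ A , id ]` maps into `δ A`. Functoriality turns these morphisms into the two
        -- sides of the law.
        *-isEilenbergMoore : IsEilenbergMoore (δ A *)
        *-isEilenbergMoore = record
          { unital = solution-inr G (solution (δ A)) (≈-trans δ-η (≈-sym idʳ))
          ; multiplicative = ≈-sym (begin
              β ∘ T₁ β
                ≈⟨ ≈-sym (functoriality (_•_ G β (δ (T₀ A))) (δ A) (T₁ β) renaming-step) ⟩
              (_•_ G β (δ (T₀ A))) *
                ≈⟨ compositionality (δ (T₀ A)) (δ A) ⟩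
              (_□_ G (δ A) (δ (T₀ A))) * ∘ inl
                ≈⟨ functoriality (_□_ G (δ A) (δ (T₀ A))) (δ A) [ μ A , id ]
                     (□-morphism G δ-♯ (≈-trans idʳ (≈-sym
                       (≈-trans (≈-trans (+₁-cong (identity G) ≈-refl) +₁-id ⟩∘⟨refl) idˡ))))
                   ⟩∘⟨refl ⟩
              (β ∘ [ μ A , id ]) ∘ inl
                ≈⟨ pullʳ []∘inl ⟩
              β ∘ μ A ∎) }
          where
          β = δ A *
          renaming-step : δ A ∘ T₁ β ≈ (F₁ G (T₁ β) +₁ id) ∘ (_•_ G β (δ (T₀ A)))
          renaming-step = ≈-trans δ-♯ (≈-trans
            ([]-cong (≈-sym idʳ) (≈-trans (pullˡ δ-η) (≈-sym (idʳ ⟩∘⟨refl))) ⟩∘⟨refl)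
            (≈-sym (pullˡ []∘+₁)))

    α-unfolding : Unfolding K
    α-unfolding = record
      { δ = α
      ; δ-η = α∘η
      ; δ-♯ = T-ext
          (≈-trans (pullʳ ♯-τ) (≈-trans (pullˡ α∘τ)
            (≈-sym (≈-trans (pullʳ α∘τ) []∘inl))))
          (≈-trans (pullʳ ♯-η) (≈-sym (≈-trans (pullʳ α∘η) []∘inr))) }

    -- From Eilenberg-Moore algebras back to Elgot algebras.

    module _ {A : Obj} {k : F₀ K A ⇒ A} {β : T₀ A ⇒ A}
             (β-hom : β ∘ τ A ≈ k ∘ F₁ K β) (β-EM : IsEilenbergMoore β) where
      open IsEilenbergMoore β-EM

      unfold-renaming : ∀ {X Y Z} (h : Y ⇒ Z) (eq : FlatEquation K X Y) →
                        Fin.unfold Z (_•_ K h eq) ≈ T₁ h ∘ Fin.unfold Y eq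
      unfold-renaming {Y = Y} {Z} h eq = Fin.unfold-unique Z (begin
        α Z ∘ (T₁ h ∘ c)
          ≈⟨ pullˡ (Unfolding.δ-♯ α-unfolding) ⟩
        ([ inl ∘ F₁ K (T₁ h) , α Z ∘ (η Z ∘ h) ] ∘ α Y) ∘ c
          ≈⟨ pullʳ (Fin.unfold-comm Y) ⟩
        [ inl ∘ F₁ K (T₁ h) , α Z ∘ (η Z ∘ h) ] ∘ ((F₁ K c +₁ id) ∘ eq)
          ≈⟨ pullˡ []∘+₁ ⟩
        [ (inl ∘ F₁ K (T₁ h)) ∘ F₁ K c , (α Z ∘ (η Z ∘ h)) ∘ id ] ∘ eq
          ≈⟨ []-cong
               (≈-trans (pullʳ (≈-sym (homomorphism K))) (≈-sym idʳ))
               (≈-trans idʳ (≈-trans (pullˡ α∘η) (≈-sym (idʳ ⟩∘⟨refl)))) ⟩∘⟨refl ⟩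
        [ (inl ∘ F₁ K (T₁ h ∘ c)) ∘ id , (inr ∘ id) ∘ h ] ∘ eq
          ≈⟨ ≈-sym (pullˡ []∘+₁) ⟩
        (F₁ K (T₁ h ∘ c) +₁ id) ∘ ((id +₁ h) ∘ eq) ∎)
        where c = Fin.unfold Y eq

      -- The map `[ d ♯ ∘ c , d ]`, which grafts the trees of `f` onto the leaves of those of `eq`,
      -- is a coalgebra morphism from `f □ eq`; finality makes it the unfolding.
      unfold-□ : ∀ {X Y Z} (eq : FlatEquation K X Y) (f : FlatEquation K Y Z) →
                 Fin.unfold Z (_□_ K f eq) ∘ inl ≈ Fin.unfold Z f ♯ ∘ Fin.unfold Y eq
      unfold-□ {Y = Y} {Z} eq f = ≈-trans
        (Fin.unfold-unique Z (□-morphism K morphism (Fin.unfold-comm Z)) ⟩∘⟨refl)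
        []∘inl
        where
        c = Fin.unfold Y eq
        d = Fin.unfold Z f
        morphism : α Z ∘ (d ♯ ∘ c) ≈ [ inl ∘ F₁ K (d ♯ ∘ c) , α Z ∘ d ] ∘ eq
        morphism = begin
          α Z ∘ (d ♯ ∘ c)
            ≈⟨ pullˡ (Unfolding.δ-♯ α-unfolding) ⟩
          ([ inl ∘ F₁ K (d ♯) , α Z ∘ d ] ∘ α Y) ∘ c
            ≈⟨ pullʳ (Fin.unfold-comm Y) ⟩
          [ inl ∘ F₁ K (d ♯) , α Z ∘ d ] ∘ ((F₁ K c +₁ id) ∘ eq)
            ≈⟨ pullˡ []∘+₁ ⟩
          [ (inl ∘ F₁ K (d ♯)) ∘ F₁ K c , (α Z ∘ d) ∘ id ] ∘ eq
            ≈⟨ []-cong (pullʳ (≈-sym (homomorphism K))) idʳ ⟩∘⟨refl ⟩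
          [ inl ∘ F₁ K (d ♯ ∘ c) , α Z ∘ d ] ∘ eq ∎

      β-solves-α : β ≈ [ k , id ] ∘ ((F₁ K β +₁ id) ∘ α A)
      β-solves-α = ≈-sym (≈-trans (pullˡ []∘+₁) (T-ext
        (≈-trans (pullʳ α∘τ) (≈-trans []∘inl (≈-sym β-hom)))
        (≈-trans (pullʳ α∘η) (≈-trans []∘inr (≈-trans idˡ (≈-sym unital))))))

      -- A system is solved by unfolding it to a tree over `A` and evaluating the tree with `β`.
      -- Functoriality then comes from finality alone, and compositionality from the multiplication
      -- law.
      EilenbergMoore⇒Elgot : ElgotStructure {K} (A , k)
      EilenbergMoore⇒Elgot = record
        { _* = λ eq → β ∘ Fin.unfold A eq
        ; solution = λ eq → let c = Fin.unfold A eq in begin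
            β ∘ c
              ≈⟨ β-solves-α ⟩∘⟨refl ⟩
            ([ k , id ] ∘ ((F₁ K β +₁ id) ∘ α A)) ∘ c
              ≈⟨ pullʳ (pullʳ (Fin.unfold-comm A)) ⟩
            [ k , id ] ∘ ((F₁ K β +₁ id) ∘ ((F₁ K c +₁ id) ∘ eq))
              ≈⟨ refl⟩∘⟨ pullˡ (≈-trans (≈-sym +₁-∘) (+₁-cong (≈-sym (homomorphism K)) idˡ)) ⟩
            [ k , id ] ∘ ((F₁ K (β ∘ c) +₁ id) ∘ eq) ∎
        ; functoriality = λ eq f h p → ≈-trans (refl⟩∘⟨ Fin.unfold-unique A (begin
            α A ∘ (Fin.unfold A f ∘ h)
              ≈⟨ pullˡ (Fin.unfold-comm A) ⟩
            ((F₁ K (Fin.unfold A f) +₁ id) ∘ f) ∘ h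
              ≈⟨ pullʳ p ⟩
            (F₁ K (Fin.unfold A f) +₁ id) ∘ ((F₁ K h +₁ id) ∘ eq)
              ≈⟨ pullˡ (≈-trans (≈-sym +₁-∘) (+₁-cong (≈-sym (homomorphism K)) idˡ)) ⟩
            (F₁ K (Fin.unfold A f ∘ h) +₁ id) ∘ eq ∎)) (≈-sym assoc)
        ; compositionality = λ {X} {Y} eq f →
            let c = Fin.unfold Y eq ; d = Fin.unfold A f in begin
            β ∘ Fin.unfold A (_•_ K (β ∘ d) eq)   ≈⟨ refl⟩∘⟨ unfold-renaming (β ∘ d) eq ⟩
            β ∘ (T₁ (β ∘ d) ∘ c)                  ≈⟨ refl⟩∘⟨ homomorphism functor ⟩∘⟨refl ⟩
            β ∘ ((T₁ β ∘ T₁ d) ∘ c)               ≈⟨ refl⟩∘⟨ assoc ⟩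
            β ∘ (T₁ β ∘ (T₁ d ∘ c))               ≈⟨ pullˡ (≈-sym multiplicative) ⟩
            (β ∘ μ A) ∘ (T₁ d ∘ c)                ≈⟨ pullʳ (pullˡ μ-T₁) ⟩
            β ∘ (d ♯ ∘ c)                         ≈⟨ refl⟩∘⟨ ≈-sym (unfold-□ eq f) ⟩
            β ∘ (Fin.unfold A (_□_ K f eq) ∘ inl) ≈⟨ ≈-sym assoc ⟩
            (β ∘ Fin.unfold A (_□_ K f eq)) ∘ inl ∎ }

      -- The final coalgebra unfolds itself by the identity.
      evaluation≈β : ElgotStructure._* {K} EilenbergMoore⇒Elgot (α A) ≈ β
      evaluation≈β = ≈-trans (refl⟩∘⟨ Fin.unfold-unique A (≈-trans idʳ (≈-sym
        (≈-trans (≈-trans (+₁-cong (identity K) ≈-refl) +₁-id ⟩∘⟨refl) idˡ)))) idʳ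

  -- Unfolding the head symbol of a term along the scheme.

  module _ (H V : Endofunctor 𝒜) (it : Iteratable (H ⊕ V))
           (rps : RecursiveProgramScheme H V it) (guarded : Guarded H V it rps) where
    open T (H ⊕ V) it using
      (T₀; T₁; α; τ; η; μ; κ; _♯; functor; T-ext; α∘τ; α∘η; ♯-τ; ♯-η; ♯-∘; ♯-cong; μ-T₁)

    private
      f : NaturalTransformation V (H ∘F functor)
      f = proj₁ guarded

      fₓ : ∀ X → F₀ V X ⇒ F₀ H (T₀ X)
      fₓ = component f

      ρₓ : ∀ X → F₀ H X + F₀ V X ⇒ F₀ H (T₀ X) + F₀ V (T₀ X)
      ρₓ = component (ρ H V it rps guarded)

      -- Unfolds to the extension `T.t` of `ρ`, so `t-guarded`, `t-η` and `t-κ` apply to it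
      -- directly.
      t : ∀ X → T₀ X ⇒ T₀ X
      t = ê-component H V it rps guarded

    -- Exposes a head symbol from `H`: one already there is kept, while one from `V` is expanded by
    -- the scheme and its argument terms are merged by `μ`.
    w : ∀ X → F₀ H (T₀ X) + F₀ V (T₀ X) ⇒ F₀ H (T₀ X)
    w X = [ id , F₁ H (μ X) ∘ fₓ (T₀ X) ]

    ♯-μ : ∀ {X Z} {g : X ⇒ T₀ Z} → g ♯ ∘ μ X ≈ μ Z ∘ T₁ (g ♯)
    ♯-μ = ≈-trans (≈-sym ♯-∘) (≈-trans (♯-cong idʳ) (≈-sym μ-T₁))

    -- Naturality of `f` carries the substitution past the expansion, and `♯-μ` carries it past the
    -- merging.
    w-♯ : ∀ {X Z} {g : X ⇒ T₀ Z} → w Z ∘ (F₁ H (g ♯) +₁ F₁ V (g ♯)) ≈ F₁ H (g ♯) ∘ w X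
    w-♯ {X} {Z} {g} = ≈-trans []∘+₁ (≈-trans ([]-cong (≈-trans idˡ (≈-sym idʳ)) (begin
      (F₁ H (μ Z) ∘ fₓ (T₀ Z)) ∘ F₁ V (g ♯)        ≈⟨ pullʳ (natural f (g ♯)) ⟩
      F₁ H (μ Z) ∘ (F₁ H (T₁ (g ♯)) ∘ fₓ (T₀ X))   ≈⟨ pullˡ (F₁-square H (≈-sym ♯-μ)) ⟩
      (F₁ H (g ♯) ∘ F₁ H (μ X)) ∘ fₓ (T₀ X)        ≈⟨ assoc ⟩
      F₁ H (g ♯) ∘ (F₁ H (μ X) ∘ fₓ (T₀ X))        ∎)) (≈-sym ∘[]))

    δ-head : ∀ X → FlatEquation H (T₀ X) X
    δ-head X = (w X +₁ id) ∘ α X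

    δ-head-τ : ∀ {X} → δ-head X ∘ τ X ≈ inl ∘ w X
    δ-head-τ = ≈-trans (pullʳ α∘τ) []∘inl

    δ-head-η : ∀ {X} → δ-head X ∘ η X ≈ inr
    δ-head-η = ≈-trans (pullʳ α∘η) (≈-trans []∘inr idʳ)

    head-unfolding : Unfolding (H ⊕ V) it H
    head-unfolding = record
      { δ = δ-head
      ; δ-η = δ-head-η
      ; δ-♯ = λ {X} {Z} {g} → T-ext
          (begin
            (δ-head Z ∘ g ♯) ∘ τ X                           ≈⟨ pullʳ ♯-τ ⟩
            δ-head Z ∘ (τ Z ∘ (F₁ H (g ♯) +₁ F₁ V (g ♯)))    ≈⟨ pullˡ δ-head-τ ⟩
            (inl ∘ w Z) ∘ (F₁ H (g ♯) +₁ F₁ V (g ♯))         ≈⟨ pullʳ w-♯ ⟩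
            inl ∘ (F₁ H (g ♯) ∘ w X)                         ≈⟨ ≈-sym assoc ⟩
            (inl ∘ F₁ H (g ♯)) ∘ w X                         ≈⟨ ≈-sym (pullˡ []∘inl) ⟩
            [ inl ∘ F₁ H (g ♯) , δ-head Z ∘ g ] ∘ (inl ∘ w X)
              ≈⟨ ≈-sym (pullʳ δ-head-τ) ⟩
            ([ inl ∘ F₁ H (g ♯) , δ-head Z ∘ g ] ∘ δ-head X) ∘ τ X ∎)
          (≈-trans (pullʳ ♯-η) (≈-sym (≈-trans (pullʳ δ-head-η) []∘inr))) }

    -- The common source on which `t X ♯` and `μ X` are compared. It unfolds the outer term; where
    -- that is a variable, hence an inner term, the head of the latter is rewritten by `ρ` and
    -- exposed by `w`.
    ζ : ∀ X → FlatEquation H (T₀ (T₀ X)) X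
    ζ X = [ inl , ((w (T₀ X) ∘ ρₓ (T₀ X)) +₁ id) ∘ α X ] ∘ δ-head (T₀ X)

    w∘ρ : ∀ {X} → w X ∘ ρₓ X ≈ [ F₁ H (η X) , fₓ X ]
    w∘ρ {X} = ≈-trans ∘[] ([]-cong (cancelˡ []∘inl) (cancelˡ []∘inl))

    ♯-morphism : ∀ {X} {g : T₀ X ⇒ T₀ X} →
                 δ-head X ∘ g ≈ (F₁ H (g ♯) +₁ id) ∘ (((w (T₀ X) ∘ ρₓ (T₀ X)) +₁ id) ∘ α X) →
                 δ-head X ∘ g ♯ ≈ (F₁ H (g ♯) +₁ id) ∘ ζ X
    ♯-morphism p = ≈-trans (Unfolding.δ-♯ head-unfolding) (≈-sym
      (pullˡ (≈-trans ∘[] ([]-cong []∘inl (≈-sym p)))))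

    -- `ζ` is built from `ρ` so that the recursive equation `t-guarded`, followed by `w-♯`, yields
    -- exactly its inner branch.
    t-morphism : ∀ {X} → δ-head X ∘ t X ♯ ≈ (F₁ H (t X ♯) +₁ id) ∘ ζ X
    t-morphism {X} = ♯-morphism (T-ext
      (begin
        (δ-head X ∘ t X) ∘ τ X
          ≈⟨ pullʳ (T.t-guarded (H ⊕ V) it (ρ H V it rps guarded)) ⟩
        δ-head X ∘ (τ X ∘ ((F₁ H (t X ♯) +₁ F₁ V (t X ♯)) ∘ ρₓ (T₀ X)))
          ≈⟨ pullˡ δ-head-τ ⟩
        (inl ∘ w X) ∘ ((F₁ H (t X ♯) +₁ F₁ V (t X ♯)) ∘ ρₓ (T₀ X))
          ≈⟨ pullʳ (pullˡ w-♯) ⟩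
        inl ∘ ((F₁ H (t X ♯) ∘ w (T₀ X)) ∘ ρₓ (T₀ X))
          ≈⟨ ≈-trans (refl⟩∘⟨ assoc) (≈-sym assoc) ⟩
        (inl ∘ F₁ H (t X ♯)) ∘ (w (T₀ X) ∘ ρₓ (T₀ X))
          ≈⟨ ≈-sym (≈-trans (pullʳ (≈-trans (pullʳ α∘τ) []∘inl)) (pullˡ []∘inl)) ⟩
        ((F₁ H (t X ♯) +₁ id) ∘ (((w (T₀ X) ∘ ρₓ (T₀ X)) +₁ id) ∘ α X)) ∘ τ X ∎)
      (≈-trans (≈-trans (pullʳ (T.t-η (H ⊕ V) it (ρ H V it rps guarded))) δ-head-η)
        (≈-sym (≈-trans (pullʳ (≈-trans (pullʳ α∘η) (≈-trans []∘inr idʳ)))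
          (≈-trans []∘inr idʳ)))))

    -- Applying `F₁ H (μ X)` to the inner branch cancels the unit in `w∘ρ` on the `H` side and
    -- recovers `w X`.
    μ-morphism : ∀ {X} → δ-head X ∘ μ X ≈ (F₁ H (μ X) +₁ id) ∘ ζ X
    μ-morphism {X} = ♯-morphism (≈-trans idʳ (≈-sym (pullˡ (≈-trans (≈-sym +₁-∘)
      (+₁-cong (≈-trans (refl⟩∘⟨ w∘ρ) (≈-trans ∘[] ([]-cong (F₁-inverse H ♯-η) ≈-refl)))
               idˡ)))))

    module _ {A : Obj} {a : F₀ H A ⇒ A} {β : T₀ A ⇒ A}
             (β-EM : IsEilenbergMoore (H ⊕ V) it β) where

      structure-∘ : [ a , a ∘ (F₁ H β ∘ fₓ A) ] ∘ (F₁ H β +₁ F₁ V β) ≈ a ∘ (F₁ H β ∘ w A)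
      structure-∘ = ≈-trans []∘+₁ (≈-trans ([]-cong (refl⟩∘⟨ ≈-sym idʳ) (begin
        (a ∘ (F₁ H β ∘ fₓ A)) ∘ F₁ V β                ≈⟨ pullʳ (pullʳ (natural f β)) ⟩
        a ∘ (F₁ H β ∘ (F₁ H (T₁ β) ∘ fₓ (T₀ A)))
          ≈⟨ refl⟩∘⟨ pullˡ (F₁-square H (≈-sym (IsEilenbergMoore.multiplicative β-EM))) ⟩
        a ∘ ((F₁ H β ∘ F₁ H (μ A)) ∘ fₓ (T₀ A))       ≈⟨ refl⟩∘⟨ assoc ⟩
        a ∘ (F₁ H β ∘ (F₁ H (μ A) ∘ fₓ (T₀ A)))       ∎))
        (≈-sym (≈-trans (refl⟩∘⟨ ∘[]) ∘[])))

    -- Existence of an interpreted solution.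

    module _ (𝔸 : CompleteElgotAlgebra H) where
      open CompleteElgotAlgebra 𝔸 renaming (carrier to A; structure to a)

      β : T₀ A ⇒ A
      β = δ-head A *

      interpretation : F₀ V A ⇒ A
      interpretation = a ∘ (F₁ H β ∘ fₓ A)

      β-isEilenbergMoore : IsEilenbergMoore (H ⊕ V) it β
      β-isEilenbergMoore = Unfolding.*-isEilenbergMoore head-unfolding elgotStructure

      β-homomorphism : β ∘ τ A ≈ [ a , interpretation ] ∘ (F₁ H β +₁ F₁ V β)
      β-homomorphism = ≈-trans (solution-inl H (solution (δ-head A)) δ-head-τ)
        (≈-sym (structure-∘ β-isEilenbergMoore))

      β∘t : β ∘ t A ≈ β
      β∘t = begin
        β ∘ t A                ≈⟨ refl⟩∘⟨ ≈-sym ♯-η ⟩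
        -- By functoriality both `β ∘ t A ♯` and `β ∘ μ A` equal the chosen solution of `ζ A`.
        β ∘ (t A ♯ ∘ η (T₀ A)) ≈⟨ pullˡ (≈-trans
          (≈-sym (functoriality (ζ A) (δ-head A) (t A ♯) t-morphism))
          (functoriality (ζ A) (δ-head A) (μ A) μ-morphism)) ⟩
        (β ∘ μ A) ∘ η (T₀ A)   ≈⟨ ≈-trans (pullʳ ♯-η) idʳ ⟩
        β                      ∎

      interpretation-isInterpretedSolution :
        IsInterpretedSolution H V it rps guarded algebra interpretation
      interpretation-isInterpretedSolution = record
        { elgotStructure = EilenbergMoore⇒Elgot (H ⊕ V) it β-homomorphism β-isEilenbergMoore
        ; β∘ê = ≈-trans (eval ⟩∘⟨refl) (≈-trans β∘t (≈-sym eval)) }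
        where eval = evaluation≈β (H ⊕ V) it β-homomorphism β-isEilenbergMoore

      -- Uniqueness over a completely iterative algebra.

      module _ (cia : IsCompletelyIterative {H} algebra) {s : F₀ V A ⇒ A}
               (int : IsInterpretedSolution H V it rps guarded algebra s) where
        open IsInterpretedSolution int using (β∘ê) renaming (elgotStructure to S; β to γ)

        γ-isEilenbergMoore : IsEilenbergMoore (H ⊕ V) it γ
        γ-isEilenbergMoore = Unfolding.*-isEilenbergMoore (α-unfolding (H ⊕ V) it) S

        γ-homomorphism : γ ∘ τ A ≈ [ a , s ] ∘ (F₁ H γ +₁ F₁ V γ)
        γ-homomorphism = ≈-trans
          (solution-inl (H ⊕ V) (ElgotStructure.solution {H ⊕ V} S (α A)) (≈-trans α∘τ (≈-sym idʳ)))
          (refl⟩∘⟨ idʳ)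

        γ-unital : γ ∘ η A ≈ id
        γ-unital = IsEilenbergMoore.unital γ-isEilenbergMoore

        γ∘κ : γ ∘ κ A ≈ [ a , s ]
        γ∘κ = ≈-trans (pullˡ γ-homomorphism)
          (≈-trans (pullʳ (F₁-inverse (H ⊕ V) γ-unital)) idʳ)

        -- Invariance of `γ` under `ê` allows a single `V` symbol to be replaced by its guarded
        -- right-hand side before evaluation; guardedness makes the new head an `H` symbol,
        -- interpreted by `a`.
        s-via-γ : s ≈ a ∘ (F₁ H γ ∘ fₓ A)
        s-via-γ = begin
          s                                   ≈⟨ ≈-sym []∘inr ⟩
          [ a , s ] ∘ inr                     ≈⟨ ≈-sym γ∘κ ⟩∘⟨refl ⟩
          (γ ∘ κ A) ∘ inr                     ≈⟨ (≈-sym β∘ê ⟩∘⟨refl) ⟩∘⟨refl ⟩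
          ((γ ∘ t A) ∘ κ A) ∘ inr
            ≈⟨ pullʳ (T.t-κ (H ⊕ V) it (ρ H V it rps guarded)) ⟩∘⟨refl ⟩
          (γ ∘ (τ A ∘ ρₓ A)) ∘ inr            ≈⟨ pullʳ (pullʳ []∘inr) ⟩
          γ ∘ (τ A ∘ (inl ∘ fₓ A))            ≈⟨ pullˡ γ-homomorphism ⟩
          ([ a , s ] ∘ (F₁ H γ +₁ F₁ V γ)) ∘ (inl ∘ fₓ A)
            ≈⟨ pullʳ (pullˡ []∘inl) ⟩
          [ a , s ] ∘ ((inl ∘ F₁ H γ) ∘ fₓ A) ≈⟨ refl⟩∘⟨ assoc ⟩
          [ a , s ] ∘ (inl ∘ (F₁ H γ ∘ fₓ A)) ≈⟨ pullˡ []∘inl ⟩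
          a ∘ (F₁ H γ ∘ fₓ A)                 ∎

        γ-solves-δ-head : IsSolution {H} algebra (δ-head A) γ
        γ-solves-δ-head = ≈-sym (T-ext
          (begin
            ([ a , id ] ∘ ((F₁ H γ +₁ id) ∘ δ-head A)) ∘ τ A
              ≈⟨ pullʳ (pullʳ δ-head-τ) ⟩
            [ a , id ] ∘ ((F₁ H γ +₁ id) ∘ (inl ∘ w A))
              ≈⟨ refl⟩∘⟨ ≈-trans (pullˡ []∘inl) assoc ⟩
            [ a , id ] ∘ (inl ∘ (F₁ H γ ∘ w A))
              ≈⟨ pullˡ []∘inl ⟩
            a ∘ (F₁ H γ ∘ w A)
              ≈⟨ ≈-sym (structure-∘ γ-isEilenbergMoore) ⟩
            [ a , a ∘ (F₁ H γ ∘ fₓ A) ] ∘ (F₁ H γ +₁ F₁ V γ)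
              ≈⟨ []-cong ≈-refl (≈-sym s-via-γ) ⟩∘⟨refl ⟩
            [ a , s ] ∘ (F₁ H γ +₁ F₁ V γ)
              ≈⟨ ≈-sym γ-homomorphism ⟩
            γ ∘ τ A ∎)
          (≈-trans (pullʳ (pullʳ δ-head-η)) (≈-trans (refl⟩∘⟨ ≈-trans []∘inr idʳ)
            (≈-trans []∘inr (≈-sym γ-unital)))))

        interpretedSolution-unique : s ≈ interpretation
        interpretedSolution-unique = ≈-trans s-via-γ
          (refl⟩∘⟨ F-resp-≈ H γ≈β ⟩∘⟨refl)
          where
          unique = proj₂ (proj₂ (cia (δ-head A)))
          γ≈β : γ ≈ β
          -- Whatever the given Elgot structure chooses for `δ-head A` is a solution, hence the
          -- unique one.
          γ≈β = ≈-trans (≈-sym (unique γ-solves-δ-head)) (unique (solution (δ-head A)))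

theorem7p5 : ∀ {o ℓ e} (𝒜 : Category o ℓ e) (cop : FiniteCoproducts 𝒜) →
    FiniteCoproducts.MonomorphicInjections cop →
    (H V : Endofunctor 𝒜) →
    Schemes.Iteratable cop H →
    Schemes.Iteratable cop V →
    (it : Schemes.Iteratable cop (Schemes._⊕_ cop H V)) →
    (𝔸 : Schemes.CompleteElgotAlgebra cop H) →
    (rps : Schemes.RecursiveProgramScheme cop H V it) →
    (guarded : Schemes.Guarded cop H V it rps) →
    Σ[ rps‡ ∈ Category._⇒_ 𝒜 (Endofunctor.F₀ V (Schemes.CompleteElgotAlgebra.carrier 𝔸))
    (Schemes.CompleteElgotAlgebra.carrier 𝔸) ]
    (Schemes.IsInterpretedSolution cop H V it rps guarded
    (Schemes.CompleteElgotAlgebra.algebra 𝔸) rps‡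
    × (Schemes.IsCompletelyIterative cop (Schemes.CompleteElgotAlgebra.algebra 𝔸) →
    ∀ s → Schemes.IsInterpretedSolution cop H V it rps guarded
    (Schemes.CompleteElgotAlgebra.algebra 𝔸) s →
    Category._≈_ 𝒜 s rps‡))
theorem7p5 𝒜 cop _ H V _ _ it 𝔸 rps guarded =
    interpretation cop H V it rps guarded 𝔸
  , interpretation-isInterpretedSolution cop H V it rps guarded 𝔸
  , λ cia s → interpretedSolution-unique cop H V it rps guarded 𝔸 cia {s}
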